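{- Let $k$ be a positive integer and let $b_k(x)=\sum_{n=0}^{\infty}b_{k,n}x^n$ be the ordinary generating function (a formal power series in $x$) of the binomial transform $\{b_{k,n}\}_{n\ge0}$ of the higher order Mersenne sequence. Then $$b_k(x)=\frac{x}{1-(2+m_k)x+2m_kx^2} .$$
   Context: The Mersenne numbers $\{M_n\}_{n\ge 0}$ are defined by $M_0=0$, $M_1=1$, $M_{n+2}=3M_{n+1}-2M_n$, i.e. $M_n=2^n-1$. The Mersenne-Lucas numbers satisfy the same recurrence with $m_0=2$, $m_1=3$, i.e. $m_n=2^n+1$. For a positive integer $k$, the higher order Mersenne numbers are $M_n^{(k)}=M_{kn}/M_k$ for $n=0,1,2,\dots$, and their binomial transform is $b_{k,n}=\sum_{i=0}^{n}\binom{n}{i}M_i^{(k)}$ for $n\ge 0$. -}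

module Defs where

open import Data.Bool.Base using (if_then_else_)
open import Data.Fin.Base using (toℕ)
open import Data.Integer.Base as ℤ using (ℤ; +_; -[1+_])
open import Data.Integer.Tactic.RingSolver using (solve-∀)
open import Data.Nat.Base as ℕ using (ℕ; zero; suc; _∸_; _≡ᵇ_)
open import Data.Nat.Combinatorics using (_C_)
open import Data.Rational.Base using (ℚ; _+_; _-_; -_; _*_; _÷_; 1/_; NonZero)
open import Data.Rational.Literals using (fromℤ)
import Data.Rational.Properties as ℚ
open import Relation.Binary.PropositionalEquality

open import Algebra.Properties.Monoid.Sum ℚ.+-0-monoid using (sum⁺-syntax)

infix  4 _≈_
infixl 6 _+ˢ_ _-ˢ_
infixl 7 _*ˢ_ _/ˢ_
infix  8 _·x^_

M : ℕ → ℤ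
M 0             = + 0
M 1             = + 1
M (suc (suc n)) = + 3 ℤ.* M (suc n) ℤ.- + 2 ℤ.* M n

m : ℕ → ℤ
m 0             = + 2
m 1             = + 3
m (suc (suc n)) = + 3 ℤ.* m (suc n) ℤ.- + 2 ℤ.* m n

M-suc : ∀ n → M (suc n) ≡ + 1 ℤ.+ + 2 ℤ.* M n
M-suc zero    = refl
M-suc (suc n) = trans (cong (λ z → + 3 ℤ.* z ℤ.- + 2 ℤ.* M n) (M-suc n))
               (trans (lemma (M n)) (cong (λ z → + 1 ℤ.+ + 2 ℤ.* z) (sym (M-suc n))))
  where
  lemma : ∀ a → + 3 ℤ.* (+ 1 ℤ.+ + 2 ℤ.* a) ℤ.- + 2 ℤ.* a
              ≡ + 1 ℤ.+ + 2 ℤ.* (+ 1 ℤ.+ + 2 ℤ.* a)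
  lemma = solve-∀

M-nonZero : ∀ k .{{_ : ℕ.NonZero k}} → NonZero (fromℤ (M k))
M-nonZero (suc n) = subst ℤ.NonZero (sym (M-suc n)) (odd (M n))
  where
  odd : ∀ z → ℤ.NonZero (+ 1 ℤ.+ + 2 ℤ.* z)
  odd (+ zero)       = _
  odd (+ (suc _))    = _
  odd -[1+ zero ]    = _
  odd -[1+ suc _ ]   = _

-- The quotient is taken in ℚ, so integrality of M (k n) / M k is not presupposed.
higherM : (k : ℕ) .{{_ : ℕ.NonZero k}} → ℕ → ℚ
higherM k n = _÷_ (fromℤ (M (k ℕ.* n))) (fromℤ (M k)) {{M-nonZero k}}

b : (k : ℕ) .{{_ : ℕ.NonZero k}} → ℕ → ℚ
b k n = ∑[ i ≤ n ] (fromℤ (+ (n C toℕ i)) * higherM k (toℕ i))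

-- A formal power series over ℚ is its sequence of coefficients.
PowerSeries : Set
PowerSeries = ℕ → ℚ

_≈_ : PowerSeries → PowerSeries → Set
A ≈ B = ∀ n → A n ≡ B n

ogf : (ℕ → ℚ) → PowerSeries
ogf a = a

_·x^_ : ℚ → ℕ → PowerSeries
(c ·x^ d) n = if n ≡ᵇ d then c else fromℤ (+ 0)

_+ˢ_ _-ˢ_ _*ˢ_ : PowerSeries → PowerSeries → PowerSeries
(A +ˢ B) n = A n + B n
(A -ˢ B) n = A n - B n
(A *ˢ B) n = ∑[ i ≤ n ] (A (toℕ i) * B (n ∸ toℕ i))

-- Long division by ascending powers of x: after the leading coefficient
-- q = A 0 / D 0 is split off, A - q D has no constant term, and
-- (A - q D) / x is divided by D in turn. See /ˢ-*ˢ for the defining property.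
_/ˢ_ : (A D : PowerSeries) .{{_ : NonZero (D 0)}} → PowerSeries
(A /ˢ D) zero    = A 0 ÷ D 0
(A /ˢ D) (suc n) = ((λ j → A (suc j) - (A 0 ÷ D 0) * D (suc j)) /ˢ D) n

/ˢ-*ˢ : ∀ A D .{{_ : NonZero (D 0)}} → (A /ˢ D) *ˢ D ≈ A
/ˢ-*ˢ A D zero = begin
  A 0 * 1/ D 0 * D 0 + fromℤ (+ 0) ≡⟨ ℚ.+-identityʳ _ ⟩
  A 0 * 1/ D 0 * D 0               ≡⟨ ℚ.*-assoc (A 0) (1/ D 0) (D 0) ⟩
  A 0 * (1/ D 0 * D 0)             ≡⟨ cong (A 0 *_) (ℚ.*-inverseˡ (D 0)) ⟩
  A 0 * fromℤ (+ 1)                ≡⟨ ℚ.*-identityʳ (A 0) ⟩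
  A 0                              ∎
  where open ≡-Reasoning
/ˢ-*ˢ A D (suc n) = begin
  t + ((R /ˢ D) *ˢ D) n   ≡⟨ cong (λ z → t + z) (/ˢ-*ˢ R D n) ⟩
  t + (A (suc n) - t)     ≡⟨ ℚ.+-comm t _ ⟩
  (A (suc n) - t) + t     ≡⟨ ℚ.+-assoc (A (suc n)) (- t) t ⟩
  A (suc n) + (- t + t)   ≡⟨ cong (λ z → A (suc n) + z) (ℚ.+-inverseˡ t) ⟩
  A (suc n) + fromℤ (+ 0) ≡⟨ ℚ.+-identityʳ (A (suc n)) ⟩
  A (suc n)               ∎
  where
  open ≡-Reasoning
  t = (A 0 ÷ D 0) * D (suc n)
  R : PowerSeries
  R j = A (suc j) - (A 0 ÷ D 0) * D (suc j)

{-# OPTIONS --safe #-}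
-- The quotient of power series is the unique u with u D = A, so the theorem
-- says that b_k starts with 0, 1 and satisfies
-- b_{k,n+2} = (2 + m_k) b_{k,n+1} - 2 m_k b_{k,n}. Since 2^k = m_k - 1, the
-- higher order sequence satisfies a_{n+2} = m_k a_{n+1} - (m_k - 1) a_n. By
-- Pascal's rule, the binomial transform T obeys T a (n+1) = T a n + T (S a) n
-- for the shift S, i.e. it conjugates the shift to 1 + S; substituting S - 1
-- for S in S² - m_k S + (m_k - 1) gives S² - (2 + m_k) S + 2 m_k.
module Submission where

open import Defs
open import Data.Fin.Base using (zero; suc; toℕ; fromℕ; inject₁)
open import Data.Fin.Properties using (toℕ-fromℕ; toℕ-inject₁)
open import Data.Integer.Base using (+_; _+_; _*_; _-_; -_)
import Data.Integer.Properties as ℤ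
open import Data.Integer.Tactic.RingSolver using (solve-∀)
open import Data.Nat.Base as ℕ using (ℕ; zero; suc; NonZero)
open import Data.Nat.Combinatorics using (_C_; nCn≡1; nCk≡nC[n∸k]; k>n⇒nCk≡0; nCk+nC[k+1]≡[n+1]C[k+1])
import Data.Nat.Properties as ℕ
open import Data.Rational.Base as ℚ using (ℚ; 0ℚ; 1ℚ)
open import Data.Rational.Literals using (fromℤ)
import Data.Rational.Properties as ℚ
open import Data.Rational.Solver using (module +-*-Solver)
import Data.Rational.Unnormalised.Base as ℚᵘ
import Data.Rational.Unnormalised.Properties as ℚᵘ
open import Data.Vec.Functional using (Vector)
open import Function.Base using (_∘_)
open import Relation.Binary.PropositionalEquality

open import Algebra.Properties.Monoid.Sum ℚ.+-0-monoid using (sum; sum⁺-syntax; sum-cong-≗; sum-init-last)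
open import Algebra.Properties.CommutativeMonoid.Sum ℚ.+-0-commutativeMonoid using (∑-distrib-+)

open +-*-Solver using (solve; con; _:=_; _:+_; _:*_; _:-_)

-- Compared among unnormalised fractions, where no gcd intervenes. For products and negations the
-- two sides there agree by computation; a sum leaves the numerator `i * + 1 + j * + 1`, hence the
-- ring lemma.
fromℤ-homo-+ : ∀ i j → fromℤ (i + j) ≡ fromℤ i ℚ.+ fromℤ j
fromℤ-homo-+ i j = ℚ.toℚᵘ-injective (ℚᵘ.≃-trans (ℚᵘ.*≡* (lemma i j)) (ℚᵘ.≃-sym (ℚ.toℚᵘ-homo-+ (fromℤ i) (fromℤ j))))
  where
  lemma : ∀ i j → (i + j) * + 1 ≡ (i * + 1 + j * + 1) * + 1
  lemma = solve-∀

fromℤ-homo-* : ∀ i j → fromℤ (i * j) ≡ fromℤ i ℚ.* fromℤ j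
fromℤ-homo-* i j = ℚ.toℚᵘ-injective (ℚᵘ.≃-sym (ℚ.toℚᵘ-homo-* (fromℤ i) (fromℤ j)))

fromℤ-homo‿- : ∀ i → fromℤ (- i) ≡ ℚ.- fromℤ i
fromℤ-homo‿- i = ℚ.toℚᵘ-injective (ℚᵘ.≃-sym (ℚ.toℚᵘ-homo‿- (fromℤ i)))

-- The constant 2 also solves the common recurrence, so comparing two initial values suffices. This
-- lets 2^k be written as `m k - + 1`.
M≡m-2 : ∀ n → M n ≡ m n - + 2
M≡m-2 zero          = refl
M≡m-2 (suc zero)    = refl
M≡m-2 (suc (suc n)) = trans (cong₂ (λ x y → + 3 * x - + 2 * y) (M≡m-2 (suc n)) (M≡m-2 n)) (lemma (m (suc n)) (m n))
  where
  lemma : ∀ x y → + 3 * (x - + 2) - + 2 * (y - + 2) ≡ (+ 3 * x - + 2 * y) - + 2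
  lemma = solve-∀

-- M_{k+j} = 2^k M_j + M_k
M-+ : ∀ k j → M (k ℕ.+ j) ≡ (m k - + 1) * M j + M k
M-+ k j = trans (M-+′ k) (cong (λ x → x * M j + M k) (trans (cong (_+ + 1) (M≡m-2 k)) (lemma (m k))))
  where
  lemma : ∀ x → x - + 2 + + 1 ≡ x - + 1
  lemma = solve-∀
  step : ∀ x y → + 1 + + 2 * ((x + + 1) * y + x) ≡ ((+ 1 + + 2 * x) + + 1) * y + (+ 1 + + 2 * x)
  step = solve-∀
  base : ∀ y → y ≡ (+ 0 + + 1) * y + + 0
  base = solve-∀
  M-+′ : ∀ k → M (k ℕ.+ j) ≡ (M k + + 1) * M j + M k
  M-+′ zero = base (M j)
  M-+′ (suc k) rewrite M-suc (k ℕ.+ j) | M-suc k | M-+′ k = step (M k) (M j)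

-- The numbers 1 and 2^k are the roots of t² - m_k t + (m_k - 1). Concretely, `M-+` makes both sides
-- polynomials in `m k` and `M j`.
M-recurrence : ∀ k j → M (k ℕ.+ (k ℕ.+ j)) ≡ m k * M (k ℕ.+ j) - (m k - + 1) * M j
M-recurrence k j rewrite M-+ k (k ℕ.+ j) | M-+ k j | M≡m-2 k = lemma (m k) (M j)
  where
  lemma : ∀ x y → (x - + 1) * ((x - + 1) * y + (x - + 2)) + (x - + 2) ≡ x * ((x - + 1) * y + (x - + 2)) - (x - + 1) * y
  lemma = solve-∀

higherM-0 : ∀ k .{{_ : NonZero k}} → higherM k 0 ≡ 0ℚ
higherM-0 k rewrite ℕ.*-zeroʳ k = ℚ.*-zeroˡ (ℚ.1/_ (fromℤ (M k)) {{M-nonZero k}})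

higherM-1 : ∀ k .{{_ : NonZero k}} → higherM k 1 ≡ 1ℚ
higherM-1 k = trans (cong (λ j → fromℤ (M j) ℚ.* ℚ.1/_ (fromℤ (M k)) {{M-nonZero k}}) (ℕ.*-identityʳ k))
                    (ℚ.*-inverseʳ (fromℤ (M k)) {{M-nonZero k}})

higherM-recurrence : ∀ k .{{_ : NonZero k}} n → let p = fromℤ (m k) in
  higherM k (suc (suc n)) ≡ p ℚ.* higherM k (suc n) ℚ.- (p ℚ.- 1ℚ) ℚ.* higherM k n
-- The rewrites turn k(n+2) into k + (k + kn), so `M-recurrence` applies with j = kn; `r` is the
-- common factor 1/M_k.
higherM-recurrence k n rewrite ℕ.*-suc k (suc n) | ℕ.*-suc k n = begin
  fromℤ (M (k ℕ.+ (k ℕ.+ j))) ℚ.* r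
    ≡⟨ cong (λ i → fromℤ i ℚ.* r) (M-recurrence k j) ⟩
  fromℤ (m k * M (k ℕ.+ j) - (m k - + 1) * M j) ℚ.* r
    ≡⟨ cong (ℚ._* r) (fromℤ-homo-+ (m k * M (k ℕ.+ j)) _) ⟩
  (fromℤ (m k * M (k ℕ.+ j)) ℚ.+ fromℤ (- ((m k - + 1) * M j))) ℚ.* r
    ≡⟨ cong₂ (λ x y → (x ℚ.+ y) ℚ.* r) (fromℤ-homo-* (m k) _) (fromℤ-homo‿- ((m k - + 1) * M j)) ⟩
  (p ℚ.* x ℚ.- fromℤ ((m k - + 1) * M j)) ℚ.* r
    ≡⟨ cong (λ z → (p ℚ.* x ℚ.- z) ℚ.* r) (trans (fromℤ-homo-* (m k - + 1) (M j)) (cong (ℚ._* y) (fromℤ-homo-+ (m k) _))) ⟩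
  (p ℚ.* x ℚ.- (p ℚ.- 1ℚ) ℚ.* y) ℚ.* r
    ≡⟨ solve 4 (λ p x y r → (p :* x :- (p :- con 1ℚ) :* y) :* r := p :* (x :* r) :- (p :- con 1ℚ) :* (y :* r)) refl p x y r ⟩
  p ℚ.* (x ℚ.* r) ℚ.- (p ℚ.- 1ℚ) ℚ.* (y ℚ.* r) ∎
  where
  open ≡-Reasoning
  j = k ℕ.* n
  p = fromℤ (m k)
  x = fromℤ (M (k ℕ.+ j))
  y = fromℤ (M j)
  r = ℚ.1/_ (fromℤ (M k)) {{M-nonZero k}}

-- Kept general so that it also applies to shifted sequences; `b k` unfolds to the case
-- `a = higherM k`.
binomialTransform : (ℕ → ℚ) → ℕ → ℚ
binomialTransform a n = ∑[ i ≤ n ] (fromℤ (+ (n C toℕ i)) ℚ.* a (toℕ i))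

nC0≡1 : ∀ n → n C 0 ≡ 1
nC0≡1 n = trans (nCk≡nC[n∸k] {0} {n} ℕ.z≤n) (nCn≡1 n)

-- The added term has coefficient `n C suc n`, which is 0. The longer sum is the one that Pascal's
-- rule produces.
binomialTransform-extend : ∀ a n → binomialTransform a n ≡
  sum {suc (suc n)} (λ i → fromℤ (+ (n C toℕ i)) ℚ.* a (toℕ i))
binomialTransform-extend a n = sym (begin
  sum {suc (suc n)} (t ∘ toℕ)
    ≡⟨ sum-init-last {suc n} (t ∘ toℕ) ⟩
  sum {suc n} (t ∘ toℕ ∘ inject₁) ℚ.+ t (toℕ (fromℕ (suc n)))
    ≡⟨ cong₂ ℚ._+_ (sum-cong-≗ {suc n} (λ i → cong t (toℕ-inject₁ i))) (cong t (toℕ-fromℕ (suc n))) ⟩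
  binomialTransform a n ℚ.+ fromℤ (+ (n C suc n)) ℚ.* a (suc n)
    ≡⟨ cong (λ c → binomialTransform a n ℚ.+ fromℤ (+ c) ℚ.* a (suc n)) (k>n⇒nCk≡0 (ℕ.n<1+n n)) ⟩
  binomialTransform a n ℚ.+ 0ℚ ℚ.* a (suc n)
    ≡⟨ solve 2 (λ x y → x :+ con 0ℚ :* y := x) refl (binomialTransform a n) (a (suc n)) ⟩
  binomialTransform a n ∎)
  where
  open ≡-Reasoning
  t : ℕ → ℚ
  t i = fromℤ (+ (n C i)) ℚ.* a i

-- Pascal's rule splits every term but the one at index 0. The `n C suc i` halves join that term to
-- form the extended sum for `a`; the `n C i` halves form the transform of the shift.
binomialTransform-suc : ∀ a n →
  binomialTransform a (suc n) ≡ binomialTransform a n ℚ.+ binomialTransform (a ∘ suc) n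
binomialTransform-suc a n = begin
  fromℤ (+ (suc n C 0)) ℚ.* a 0 ℚ.+ sum {suc n} (λ i → fromℤ (+ (suc n C suc (toℕ i))) ℚ.* a (suc (toℕ i)))
    ≡⟨ cong₂ ℚ._+_ (cong (λ c → fromℤ (+ c) ℚ.* a 0) (trans (nC0≡1 (suc n)) (sym (nC0≡1 n))))
                   (sum-cong-≗ {suc n} (pascal ∘ toℕ)) ⟩
  t₀ ℚ.+ sum {suc n} (λ i → f i ℚ.+ g i)
    ≡⟨ cong (t₀ ℚ.+_) (∑-distrib-+ {suc n} f g) ⟩
  t₀ ℚ.+ (sum {suc n} f ℚ.+ sum {suc n} g)
    ≡⟨ solve 3 (λ t f g → t :+ (f :+ g) := (t :+ g) :+ f) refl t₀ (sum {suc n} f) (sum {suc n} g) ⟩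
  (t₀ ℚ.+ sum {suc n} g) ℚ.+ sum {suc n} f
    ≡⟨ cong (ℚ._+ sum {suc n} f) (binomialTransform-extend a n) ⟨
  binomialTransform a n ℚ.+ binomialTransform (a ∘ suc) n ∎
  where
  open ≡-Reasoning
  t₀ = fromℤ (+ (n C 0)) ℚ.* a 0
  f g : Vector ℚ (suc n)
  f i = fromℤ (+ (n C toℕ i)) ℚ.* a (suc (toℕ i))
  g i = fromℤ (+ (n C suc (toℕ i))) ℚ.* a (suc (toℕ i))
  pascal : ∀ i → fromℤ (+ (suc n C suc i)) ℚ.* a (suc i) ≡
    fromℤ (+ (n C i)) ℚ.* a (suc i) ℚ.+ fromℤ (+ (n C suc i)) ℚ.* a (suc i)
  pascal i = trans
    (cong (ℚ._* a (suc i)) (trans (cong (fromℤ ∘ +_) (sym (nCk+nC[k+1]≡[n+1]C[k+1] n i)))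
                                  (fromℤ-homo-+ (+ (n C i)) (+ (n C suc i)))))
    (ℚ.*-distribʳ-+ (a (suc i)) (fromℤ (+ (n C i))) (fromℤ (+ (n C suc i))))

sum-linear : ∀ {n} p q (c x y z : Vector ℚ n) → (∀ i → z i ≡ p ℚ.* x i ℚ.- q ℚ.* y i) →
  sum (λ i → c i ℚ.* z i) ≡ p ℚ.* sum (λ i → c i ℚ.* x i) ℚ.- q ℚ.* sum (λ i → c i ℚ.* y i)
sum-linear {zero}  p q c x y z eq = solve 2 (λ p q → con 0ℚ := p :* con 0ℚ :- q :* con 0ℚ) refl p q
sum-linear {suc n} p q c x y z eq = trans
  (cong₂ (λ u v → c zero ℚ.* u ℚ.+ v) (eq zero)
    (sum-linear p q (c ∘ suc) (x ∘ suc) (y ∘ suc) (z ∘ suc) (eq ∘ suc)))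
  (solve 7 (λ p q c x y X Y → c :* (p :* x :- q :* y) :+ (p :* X :- q :* Y)
                           := p :* (c :* x :+ X) :- q :* (c :* y :+ Y))
    refl p q (c zero) (x zero) (y zero) _ _)

-- Everything reduces to `x` = T a n and `y` = T (S a) n, because `sum-linear` carries the
-- recurrence of `a` over to T (S² a) n = p y - (p - 1) x. The form with right side 0 is that of a
-- coefficient in the product with the denominator.
binomialTransform-recurrence : ∀ p a →
  (∀ n → a (suc (suc n)) ≡ p ℚ.* a (suc n) ℚ.- (p ℚ.- 1ℚ) ℚ.* a n) →
  let T = binomialTransform a in
  ∀ n → T (suc (suc n)) ℚ.- (fromℤ (+ 2) ℚ.+ p) ℚ.* T (suc n) ℚ.+ (fromℤ (+ 2) ℚ.* p) ℚ.* T n ≡ 0ℚ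
binomialTransform-recurrence p a rec n = trans
  (cong₂ (λ v w → v ℚ.- (fromℤ (+ 2) ℚ.+ p) ℚ.* w ℚ.+ (fromℤ (+ 2) ℚ.* p) ℚ.* x) eq₂ eq₁)
  (cancel p x y)
  where
  x = binomialTransform a n
  y = binomialTransform (a ∘ suc) n
  eq₁ : binomialTransform a (suc n) ≡ x ℚ.+ y
  eq₁ = binomialTransform-suc a n
  eq₂ : binomialTransform a (suc (suc n)) ≡ (x ℚ.+ y) ℚ.+ (y ℚ.+ (p ℚ.* y ℚ.- (p ℚ.- 1ℚ) ℚ.* x))
  eq₂ = trans (binomialTransform-suc a (suc n))
    (cong₂ ℚ._+_ eq₁ (trans (binomialTransform-suc (a ∘ suc) n)
      (cong (y ℚ.+_) (sum-linear {suc n} p (p ℚ.- 1ℚ) (λ i → fromℤ (+ (n C toℕ i)))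
        (λ i → a (suc (toℕ i))) (λ i → a (toℕ i)) (λ i → a (suc (suc (toℕ i)))) (λ i → rec (toℕ i))))))
  cancel : ∀ p x y → ((x ℚ.+ y) ℚ.+ (y ℚ.+ (p ℚ.* y ℚ.- (p ℚ.- 1ℚ) ℚ.* x)))
    ℚ.- (fromℤ (+ 2) ℚ.+ p) ℚ.* (x ℚ.+ y) ℚ.+ (fromℤ (+ 2) ℚ.* p) ℚ.* x ≡ 0ℚ
  cancel = solve 3
    (λ p x y → (((x :+ y) :+ (y :+ (p :* y :- (p :- con 1ℚ) :* x)))
                :- (con (fromℤ (+ 2)) :+ p) :* (x :+ y))
               :+ (con (fromℤ (+ 2)) :* p) :* x := con 0ℚ)
    refl

-- Follows the long division: the constant coefficient forces `u 0`, and the shifted series,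
-- multiplied by `D`, gives the next dividend.
/ˢ-unique : ∀ u A D .{{_ : ℚ.NonZero (D 0)}} → u *ˢ D ≈ A → u ≈ A /ˢ D
/ˢ-unique u A D uD≈A = λ where
    zero    → head-eq
    (suc n) → /ˢ-unique (u ∘ suc) _ D tail-eq n
  where
  open ≡-Reasoning
  head-eq : u 0 ≡ A 0 ℚ.÷ D 0
  head-eq = begin
    u 0                          ≡⟨ ℚ.*-identityʳ (u 0) ⟨
    u 0 ℚ.* 1ℚ                   ≡⟨ cong (u 0 ℚ.*_) (ℚ.*-inverseʳ (D 0)) ⟨
    u 0 ℚ.* (D 0 ℚ.* ℚ.1/ D 0)   ≡⟨ ℚ.*-assoc (u 0) (D 0) (ℚ.1/ D 0) ⟨
    u 0 ℚ.* D 0 ℚ.* ℚ.1/ D 0     ≡⟨ cong (ℚ._* ℚ.1/ D 0) (trans (sym (ℚ.+-identityʳ (u 0 ℚ.* D 0))) (uD≈A 0)) ⟩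
    A 0 ℚ.÷ D 0                  ∎
  tail-eq : (u ∘ suc) *ˢ D ≈ (λ j → A (suc j) ℚ.- (A 0 ℚ.÷ D 0) ℚ.* D (suc j))
  tail-eq n = begin
    s                                       ≡⟨ solve 2 (λ s t → s := (t :+ s) :- t) refl s t ⟩
    -- By computation `t + s` is the coefficient `(u *ˢ D) (suc n)` with its first summand split
    -- off.
    (t ℚ.+ s) ℚ.- t                         ≡⟨ cong₂ (λ x y → x ℚ.- y ℚ.* D (suc n)) (uD≈A (suc n)) head-eq ⟩
    A (suc n) ℚ.- (A 0 ℚ.÷ D 0) ℚ.* D (suc n) ∎
    where
    s = ((u ∘ suc) *ˢ D) n
    t = u 0 ℚ.* D (suc n)

trinomial : ℚ → ℚ → PowerSeries
trinomial c d = (fromℤ (+ 1) ·x^ 0) -ˢ (c ·x^ 1) +ˢ (d ·x^ 2)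

*ˢ-trinomial-0 : ∀ c d u → (u *ˢ trinomial c d) 0 ≡ u 0
*ˢ-trinomial-0 c d u = solve 1 (λ x → x :* con 1ℚ :+ con 0ℚ := x) refl (u 0)

*ˢ-trinomial-1 : ∀ c d u → (u *ˢ trinomial c d) 1 ≡ u 1 ℚ.- c ℚ.* u 0
*ˢ-trinomial-1 c d u = solve 3
  -- The coefficients of `trinomial` unfold to unsimplified sums over its three monomials, here
  -- `(0 - c) + 0`.
  (λ c x y → x :* ((con 0ℚ :- c) :+ con 0ℚ) :+ (y :* con 1ℚ :+ con 0ℚ) := y :- c :* x)
  refl c (u 0) (u 1)

*ˢ-trinomial-2+ : ∀ c d u n →
  (u *ˢ trinomial c d) (suc (suc n)) ≡ u (suc (suc n)) ℚ.- c ℚ.* u (suc n) ℚ.+ d ℚ.* u n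
*ˢ-trinomial-2+ c d u zero = solve 5
  (λ c d x y z → x :* (con 0ℚ :+ d) :+ (y :* ((con 0ℚ :- c) :+ con 0ℚ) :+ (z :* con 1ℚ :+ con 0ℚ))
              := (z :- c :* y) :+ d :* x)
  refl c d (u 0) (u 1) (u 2)
-- The summand at `u 0` meets a coefficient of degree at least 3, which is 0; the rest is the
-- product for the shifted series.
*ˢ-trinomial-2+ c d u (suc n) = trans
  (solve 2 (λ x s → x :* con 0ℚ :+ s := s) refl (u 0) (((u ∘ suc) *ˢ trinomial c d) (suc (suc n))))
  (*ˢ-trinomial-2+ c d (u ∘ suc) n)

b-0 : ∀ k .{{_ : NonZero k}} → b k 0 ≡ 0ℚ
b-0 k = cong (λ x → 1ℚ ℚ.* x ℚ.+ 0ℚ) (higherM-0 k)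

b-1 : ∀ k .{{_ : NonZero k}} → b k 1 ≡ 1ℚ
b-1 k = cong₂ (λ x y → 1ℚ ℚ.* x ℚ.+ (1ℚ ℚ.* y ℚ.+ 0ℚ)) (higherM-0 k) (higherM-1 k)

theorem2p24 : (k : ℕ) .{{_ : NonZero k}} →
    ogf (b k) ≈
    (fromℤ (+ 1) ·x^ 1) /ˢ
    ((fromℤ (+ 1) ·x^ 0) -ˢ (fromℤ (+ 2 + m k) ·x^ 1) +ˢ (fromℤ (+ 2 * m k) ·x^ 2))
-- The numerator x has coefficients 0, 1, 0, 0, ..., so the cases are the two initial values and the
-- recurrence.
theorem2p24 k = /ˢ-unique (b k) _ (trinomial c d) λ where
    zero          → trans (*ˢ-trinomial-0 c d (b k)) (b-0 k)
    (suc zero)    → trans (*ˢ-trinomial-1 c d (b k))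
      (trans (cong₂ (λ x y → x ℚ.- c ℚ.* y) (b-1 k) (b-0 k))
             (solve 1 (λ c → con 1ℚ :- c :* con 0ℚ := con 1ℚ) refl c))
    (suc (suc n)) → trans (*ˢ-trinomial-2+ c d (b k) n)
      (trans (cong₂ (λ x y → b k (suc (suc n)) ℚ.- x ℚ.* b k (suc n) ℚ.+ y ℚ.* b k n)
                    (fromℤ-homo-+ (+ 2) (m k)) (fromℤ-homo-* (+ 2) (m k)))
             (binomialTransform-recurrence (fromℤ (m k)) (higherM k) (higherM-recurrence k) n))
  where
  c = fromℤ (+ 2 + m k)
  d = fromℤ (+ 2 * m k)
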